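{- Let $k \ge 2$ and $n \ge 1$ be natural numbers, and let $h_k(x) = x + \left\lfloor \frac{x}{k-1} \right\rfloor + 1$ for non-negative integers $x$, with $h_k^p$ denoting the $p$-th functional iterate of $h_k$ (so $h_k^0(0)=0$). Then there exists $p \in \mathbb{N}$ with $h_k^{p-1}(0) < n(k-1) \le h_k^{p}(0)$, and for this $p$ the last number remaining in the Josephus problem with the numbers $1,2,\dots,n$ in which every $k$-th number is removed is $nk - h_k^{p}(0)$.
   Context: Josephus problem: the numbers $1,2,\dots,n$ are arranged in a circle; starting the count at $1$ and proceeding around the circle, every $k$-th number still present is removed (after a removal, counting resumes with the next remaining number), until exactly one number remains. The claim asks to identify this remaining number. -}

module Defs where

open import Data.Fin.Base using (toℕ)
open import Data.Nat.Base using (ℕ; zero; suc; 2+; _+_; _*_; _∸_; _/_; _≤_; _<_; NonZero; NonTrivial)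
open import Data.Nat.GeneralisedArithmetic using (iterate)
open import Data.Product.Base using (_×_)
open import Data.Vec.Base using (Vec; []; _∷_; _∷ʳ_; tail; tabulate)
open import Function.Base using (_∘_)
open import Level using (Level)

private
  variable
    a : Level
    A : Set a
    n : ℕ

-- A circle is a vector read from the element that is counted next; an element
-- that is counted but not removed goes to the end of the vector.
rotate : Vec A (suc n) → Vec A (suc n)
rotate (x ∷ xs) = xs ∷ʳ x

removeKth : (k : ℕ) .{{_ : NonZero k}} → Vec A (suc n) → Vec A n
removeKth k xs = tail (iterate rotate xs (k ∸ 1))

lastRemaining : (k : ℕ) .{{_ : NonZero k}} → Vec A (suc n) → A
lastRemaining {n = zero}  k (x ∷ []) = x
lastRemaining {n = suc _} k xs       = lastRemaining k (removeKth k xs)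

josephus : (k n : ℕ) .{{_ : NonZero k}} .{{_ : NonZero n}} → ℕ
josephus k n@(suc _) = lastRemaining k (tabulate {n = n} (suc ∘ toℕ))

h : (k : ℕ) .{{_ : NonTrivial k}} → ℕ → ℕ
h k@(2+ _) x = x + x / (k ∸ 1) + 1

h^ : (k : ℕ) .{{_ : NonTrivial k}} → ℕ → ℕ → ℕ
h^ k p x = iterate (h k) x p

Crosses : (k n : ℕ) .{{_ : NonTrivial k}} → ℕ → Set
Crosses k n p = 1 ≤ p × h^ k (p ∸ 1) 0 < n * (k ∸ 1) × n * (k ∸ 1) ≤ h^ k p 0

{-# OPTIONS --safe #-}
module Submission where

-- A number counted at t and not removed is counted again at some t′ > t, and the
-- survivor would be removed at count n k.  In terms of the distances
-- D = n k - t and D′ = n k - t′ this reads D = h D′, so the survivor is first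
-- counted at n k - D, where D is the first iterate of h at 0 with n (k - 1) ≤ D.
-- For the induction on n, note that h x = x + (n + 1) when
-- n (k - 1) ≤ x < (n + 1)(k - 1): passing from n to n + 1 numbers changes D by a
-- multiple of n + 1, that is, by full turns around the circle.

open import Defs
open import Data.Fin.Base using (Fin; zero; suc; toℕ; fromℕ; fromℕ<; inject₁)
open import Data.Fin.Properties using (fromℕ<-cong; fromℕ<-toℕ; toℕ-fromℕ<; toℕ-fromℕ; toℕ-inject₁; toℕ<n)
open import Data.Fin.Relation.Unary.Top using (view; ‵fromℕ; ‵inject₁)
open import Data.Nat.Base using (ℕ; zero; suc; 2+; _+_; _*_; _∸_; _/_; _%_; _≤_; _<_; z≤n; s≤s; s≤s⁻¹; NonZero; NonTrivial; nonTrivial⇒nonZero)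
open import Data.Nat.DivMod using (_mod_; m%n<n; m<n⇒m%n≡m; n%n≡0; m≡m%n+[m/n]*n; [m+kn]%n≡m%n; m<n*o⇒m/o<n; m*n/n≡m; /-monoˡ-≤)
open import Data.Nat.GeneralisedArithmetic using (iterate; iterate-is-fold)
open import Data.Nat.Properties using (≤-refl; ≤-reflexive; ≤-trans; ≤-antisym; <⇒≤; ≤-<-trans; <-≤-trans; ≤-<-connex; +-comm; +-assoc; +-suc; +-identityʳ; *-suc; +-monoʳ-≤; +-mono-<-≤; +-cancelʳ-≤; +-cancelʳ-≡; m≤m+n; m≤n+m; m+n∸n≡m; m≤n⇒∃[o]m+o≡n; module ≤-Reasoning)
open import Data.Nat.Tactic.RingSolver using (solve-∀)
open import Data.Product.Base using (∃; ∃₂; _×_; _,_)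
open import Data.Sum.Base using (inj₁; inj₂)
open import Data.Vec.Base using (Vec; []; _∷_; _∷ʳ_; lookup; tail; tabulate)
open import Data.Vec.Properties using (lookup∘tabulate)
open import Function.Base using (_∘_)
open import Level using (Level)
open import Relation.Binary.PropositionalEquality using (_≡_; refl; sym; trans; cong; module ≡-Reasoning)

private
  variable
    a : Level
    A : Set a
    n : ℕ

mod-cong : ∀ i j → i % suc n ≡ j % suc n → i mod suc n ≡ j mod suc n
mod-cong {n} i j eq = fromℕ<-cong _ _ eq (m%n<n i (suc n)) (m%n<n j (suc n))

suc-% : ∀ t n → suc (t % suc n) % suc n ≡ suc t % suc n
suc-% t n = begin
  suc (t % suc n) % suc n                          ≡⟨ [m+kn]%n≡m%n (suc (t % suc n)) (t / suc n) (suc n) ⟨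
  suc (t % suc n + t / suc n * suc n) % suc n      ≡⟨ cong (λ s → suc s % suc n) (m≡m%n+[m/n]*n t (suc n)) ⟨
  suc t % suc n                                    ∎
  where open ≡-Reasoning

-- Entry number `t` of the circle, counted from zero and reduced modulo the length, so that
-- rotations become shifts of the index and full turns are invisible.
at : Vec A (suc n) → ℕ → A
at {n = n} xs t = lookup xs (t mod suc n)

at-< : (xs : Vec A (suc n)) {t : ℕ} (t<n : t < suc n) → at xs t ≡ lookup xs (fromℕ< t<n)
at-< {n = n} xs {t} t<n = cong (lookup xs) (fromℕ<-cong _ _ (m<n⇒m%n≡m t<n) (m%n<n t (suc n)) t<n)

at-periodic : (xs : Vec A (suc n)) (t i : ℕ) → at xs (t + i * suc n) ≡ at xs t
at-periodic {n = n} xs t i = cong (lookup xs) (mod-cong (t + i * suc n) t ([m+kn]%n≡m%n t i (suc n)))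

lookup-∷ʳ-inject₁ : (xs : Vec A n) (x : A) (i : Fin n) → lookup (xs ∷ʳ x) (inject₁ i) ≡ lookup xs i
lookup-∷ʳ-inject₁ (_ ∷ _)  x zero    = refl
lookup-∷ʳ-inject₁ (_ ∷ xs) x (suc i) = lookup-∷ʳ-inject₁ xs x i

lookup-∷ʳ-fromℕ : (xs : Vec A n) (x : A) → lookup (xs ∷ʳ x) (fromℕ n) ≡ x
lookup-∷ʳ-fromℕ []       x = refl
lookup-∷ʳ-fromℕ (_ ∷ xs) x = lookup-∷ʳ-fromℕ xs x

lookup-rotate : (xs : Vec A (suc n)) (i : Fin (suc n)) → lookup (rotate xs) i ≡ at xs (suc (toℕ i))
lookup-rotate {n = n} (x ∷ xs) i with view i
-- The last position receives the old head, and the successor of the last index wraps around to `0`.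
... | ‵fromℕ = trans (lookup-∷ʳ-fromℕ xs x) (sym (cong (lookup (x ∷ xs)) (mod-cong (suc (toℕ (fromℕ n))) 0 wrap)))
  where
  wrap : suc (toℕ (fromℕ n)) % suc n ≡ 0
  wrap = trans (cong (λ t → suc t % suc n) (toℕ-fromℕ n)) (n%n≡0 (suc n))
... | ‵inject₁ j = begin
  lookup (xs ∷ʳ x) (inject₁ j)            ≡⟨ lookup-∷ʳ-inject₁ xs x j ⟩
  lookup xs j                             ≡⟨ cong (lookup (x ∷ xs)) (fromℕ<-toℕ (suc j) (s≤s (toℕ<n j))) ⟨
  lookup (x ∷ xs) (fromℕ< (s≤s (toℕ<n j))) ≡⟨ at-< (x ∷ xs) (s≤s (toℕ<n j)) ⟨
  at (x ∷ xs) (suc (toℕ j))               ≡⟨ cong (at (x ∷ xs) ∘ suc) (toℕ-inject₁ j) ⟨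
  at (x ∷ xs) (suc (toℕ (inject₁ j)))     ∎
  where open ≡-Reasoning

at-rotate : (xs : Vec A (suc n)) (t : ℕ) → at (rotate xs) t ≡ at xs (suc t)
at-rotate {n = n} xs t = begin
  lookup (rotate xs) (t mod suc n)  ≡⟨ lookup-rotate xs (t mod suc n) ⟩
  at xs (suc (toℕ (t mod suc n)))   ≡⟨ cong (at xs ∘ suc) (toℕ-fromℕ< (m%n<n t (suc n))) ⟩
  at xs (suc (t % suc n))           ≡⟨ cong (lookup xs) (mod-cong (suc (t % suc n)) (suc t) (suc-% t n)) ⟩
  at xs (suc t)                     ∎
  where open ≡-Reasoning

at-rotates : (xs : Vec A (suc n)) (c t : ℕ) → at (iterate rotate xs c) t ≡ at xs (c + t)
at-rotates xs zero    t = refl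
at-rotates xs (suc c) t = trans (at-rotates (rotate xs) c t) (at-rotate xs (c + t))

-- The two vectors have different periods, so the shift by one is claimed only within the first turn
-- of the shorter one.
at-tail : (xs : Vec A (2+ n)) {t : ℕ} → t < suc n → at (tail xs) t ≡ at xs (suc t)
at-tail (x ∷ xs) t<n = trans (at-< xs t<n) (sym (at-< (x ∷ xs) (s≤s t<n)))

-- The `k ∸ 1` rotations and the dropped head together shift the index by exactly `k`.
at-removeKth : ∀ k .{{_ : NonZero k}} (xs : Vec A (2+ n)) {t : ℕ} → t < suc n → at (removeKth k xs) t ≡ at xs (k + t)
at-removeKth k@(suc c) xs {t} t<n = begin
  at (removeKth k xs) t              ≡⟨ at-tail (iterate rotate xs c) t<n ⟩
  at (iterate rotate xs c) (suc t)   ≡⟨ at-rotates xs c (suc t) ⟩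
  at xs (c + suc t)                  ≡⟨ cong (at xs) (+-suc c t) ⟩
  at xs (k + t)                      ∎
  where open ≡-Reasoning

module _ (d : ℕ) where

  private
    m k : ℕ
    m = suc d
    k = suc m

  -- `iterate` applies the new step to the starting value; comparing it with a fold moves that step
  -- to the outside.
  h^-suc : ∀ p → h^ k (suc p) 0 ≡ h k (h^ k p 0)
  h^-suc p = trans (sym (iterate-is-fold 0 (h k) (suc p))) (cong (h k) (iterate-is-fold 0 (h k) p))

  x<h : ∀ x → x < h k x
  x<h x = ≤-trans (s≤s (m≤m+n x (x / m))) (≤-reflexive (+-comm 1 (x + x / m)))

  h^-step : ∀ p → h^ k p 0 < h^ k (suc p) 0
  h^-step p = <-≤-trans (x<h (h^ k p 0)) (≤-reflexive (sym (h^-suc p)))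

  p≤h^ : ∀ p → p ≤ h^ k p 0
  p≤h^ zero    = z≤n
  p≤h^ (suc p) = ≤-<-trans (p≤h^ p) (h^-step p)

  -- With `x < n * m` the quotient `x / m` is below `n`, so the increment is at most `n`. Hence the
  -- first iterate to reach `n * m` stays below `n * k`, and the subtraction from `n * k` is not
  -- truncated.
  h-<-bound : ∀ n {x} → x < n * m → h k x < n * k
  h-<-bound n {x} x<nm = begin-strict
    x + x / m + 1    ≡⟨ +-assoc x (x / m) 1 ⟩
    x + (x / m + 1)  ≡⟨ cong (x +_) (+-comm (x / m) 1) ⟩
    x + suc (x / m)  <⟨ +-mono-<-≤ x<nm (m<n*o⇒m/o<n {n = n} x<nm) ⟩
    n * m + n        ≡⟨ +-comm (n * m) n ⟩
    n + n * m        ≡⟨ *-suc n m ⟨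
    n * k            ∎
    where open ≤-Reasoning

  h-between : ∀ n {x} → n * m ≤ x → x < suc n * m → h k x ≡ x + suc n
  h-between n {x} nm≤x x<nm+m = begin
    x + x / m + 1  ≡⟨ cong (λ q → x + q + 1) q≡n ⟩
    x + n + 1      ≡⟨ +-assoc x n 1 ⟩
    x + (n + 1)    ≡⟨ cong (x +_) (+-comm n 1) ⟩
    x + suc n      ∎
    where
    open ≡-Reasoning
    q≡n : x / m ≡ n
    q≡n = ≤-antisym (s≤s⁻¹ (m<n*o⇒m/o<n {n = suc n} x<nm+m))
                    (≤-trans (≤-reflexive (sym (m*n/n≡m n m))) (/-monoˡ-≤ m nm≤x))

  Crosses⇒< : ∀ n p → Crosses k n p → h^ k p 0 < n * k
  Crosses⇒< n (suc p) (_ , before , _) = ≤-<-trans (≤-reflexive (h^-suc p)) (h-<-bound n before)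

  -- Descend from an iterate that has reached the threshold until its predecessor has not; the
  -- descent ends before `0`, since the threshold is positive.
  crossing : ∀ n p → suc n * m ≤ h^ k p 0 → ∃ (Crosses k (suc n))
  crossing n (suc p) reached with ≤-<-connex (suc n * m) (h^ k p 0)
  ... | inj₁ earlier = crossing n p earlier
  ... | inj₂ before  = suc p , s≤s z≤n , before , reached

  -- From the crossing `q` of the smaller threshold up to `p`, every iterate before the last lies
  -- between the two thresholds, so each of the `i` steps adds exactly `2+ n`.
  crossing-below : ∀ n p → suc n * m ≤ h^ k p 0 → h^ k (p ∸ 1) 0 < 2+ n * m →
    ∃₂ λ q i → Crosses k (suc n) q × h^ k p 0 ≡ h^ k q 0 + i * 2+ n
  crossing-below n (suc p) reached below with ≤-<-connex (suc n * m) (h^ k p 0)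
  ... | inj₂ before  = suc p , 0 , (s≤s z≤n , before , reached) , sym (+-identityʳ _)
  ... | inj₁ earlier with crossing-below n p earlier (≤-<-trans (pred≤ p) below)
    where
    -- The inequality is weak because `0 ∸ 1` is `0`.
    pred≤ : ∀ p → h^ k (p ∸ 1) 0 ≤ h^ k p 0
    pred≤ zero    = ≤-refl
    pred≤ (suc p) = <⇒≤ (h^-step p)
  ... | q , i , crosses , eq = q , suc i , crosses , (begin
    h^ k (suc p) 0                ≡⟨ h^-suc p ⟩
    h k (h^ k p 0)                ≡⟨ h-between (suc n) earlier below ⟩
    h^ k p 0 + 2+ n               ≡⟨ cong (_+ 2+ n) eq ⟩
    h^ k q 0 + i * 2+ n + 2+ n    ≡⟨ +-assoc (h^ k q 0) (i * 2+ n) (2+ n) ⟩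
    h^ k q 0 + (i * 2+ n + 2+ n)  ≡⟨ cong (h^ k q 0 +_) (+-comm (i * 2+ n) (2+ n)) ⟩
    h^ k q 0 + suc i * 2+ n       ∎)
    where open ≡-Reasoning

  -- Since `n * k` exceeds `n * m` by `n`, an iterate that has reached `n * m` leaves at most `n`
  -- for `suc t`: the survivor's first count lies in the first turn.
  index< : ∀ n p {t} → Crosses k n p → suc t + h^ k p 0 ≡ n * k → t < n
  index< n p {t} (_ , _ , reached) eq = +-cancelʳ-≤ (n * m) (suc t) n (begin
    suc t + n * m      ≤⟨ +-monoʳ-≤ (suc t) reached ⟩
    suc t + h^ k p 0   ≡⟨ eq ⟩
    n * k              ≡⟨ *-suc n m ⟩
    n + n * m          ∎)
    where open ≤-Reasoning

  -- Induction on the length. The index `t` starts at zero, and its defining equation is additive to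
  -- avoid truncated subtraction. The survivor has index `j` after one removal, hence `k + j` before
  -- it, which agrees with `t` up to full turns.
  lastRemaining-at : (xs : Vec A (suc n)) (p t : ℕ) → Crosses k (suc n) p →
    suc t + h^ k p 0 ≡ suc n * k → lastRemaining k xs ≡ at xs t
  lastRemaining-at {n = zero}  (x ∷ []) p t crosses eq with t | index< 1 p crosses eq
  ... | zero | _ = refl
  ... | suc _ | s≤s ()
  lastRemaining-at {n = suc n} xs p t crosses@(_ , before , reached) eq
    -- An iterate that has reached the larger threshold has also reached the smaller one.
    with q , i , crosses′ , h^p≡ ← crossing-below n p (≤-trans (m≤n+m (suc n * m) m) reached) before
    with j , eq′ ← m≤n⇒∃[o]m+o≡n (Crosses⇒< (suc n) q crosses′) = begin
      lastRemaining k (removeKth k xs)  ≡⟨ lastRemaining-at (removeKth k xs) q j crosses′ j-eq ⟩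
      at (removeKth k xs) j             ≡⟨ at-removeKth k xs (index< (suc n) q crosses′ j-eq) ⟩
      at xs (k + j)                     ≡⟨ cong (at xs) shift ⟩
      at xs (t + i * 2+ n)              ≡⟨ at-periodic xs t i ⟩
      at xs t                           ∎
    where
    open ≡-Reasoning
    j-eq : suc j + h^ k q 0 ≡ suc n * k
    j-eq = trans (cong suc (+-comm j (h^ k q 0))) eq′
    rearrange : ∀ t x y → suc t + (x + y) ≡ t + y + suc x
    rearrange = solve-∀
    shift : k + j ≡ t + i * 2+ n
    -- Once `suc (h^ k q 0)` is added, both sides equal `2+ n * k`.
    shift = +-cancelʳ-≡ (suc (h^ k q 0)) _ _ (begin
      k + j + suc (h^ k q 0)              ≡⟨ +-assoc k j (suc (h^ k q 0)) ⟩
      k + (j + suc (h^ k q 0))            ≡⟨ cong (k +_) (trans (+-suc j (h^ k q 0)) j-eq) ⟩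
      2+ n * k                            ≡⟨ eq ⟨
      suc t + h^ k p 0                    ≡⟨ cong (suc t +_) h^p≡ ⟩
      suc t + (h^ k q 0 + i * 2+ n)       ≡⟨ rearrange t (h^ k q 0) (i * 2+ n) ⟩
      t + i * 2+ n + suc (h^ k q 0)       ∎)

theorem3 : (k n : ℕ) .{{_ : NonTrivial k}} .{{_ : NonZero n}} →
    ∃ (λ p → Crosses k n p) ×
    (∀ p → Crosses k n p → josephus k n {{nonTrivial⇒nonZero k}} ≡ n * k ∸ h^ k p 0)
-- Every step of the iteration gains at least one, so `n * suc d` steps surely reach the threshold
-- `n * suc d`.
theorem3 k@(2+ d) n@(suc n-1) = crossing d n-1 (n * suc d) (p≤h^ d (n * suc d)) , survivor
  where
  open ≡-Reasoning
  numbers : Vec ℕ n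
  numbers = tabulate (suc ∘ toℕ)
  survivor : ∀ p → Crosses k n p → josephus k n ≡ n * k ∸ h^ k p 0
  survivor p crosses with t , eq′ ← m≤n⇒∃[o]m+o≡n (Crosses⇒< d n p crosses) = begin
    lastRemaining k numbers                ≡⟨ lastRemaining-at d numbers p t crosses eq ⟩
    at numbers t                           ≡⟨ at-< numbers t<n ⟩
    lookup numbers (fromℕ< t<n)            ≡⟨ lookup∘tabulate (suc ∘ toℕ) (fromℕ< t<n) ⟩
    suc (toℕ (fromℕ< t<n))                 ≡⟨ cong suc (toℕ-fromℕ< t<n) ⟩
    suc t                                  ≡⟨ m+n∸n≡m (suc t) (h^ k p 0) ⟨
    suc t + h^ k p 0 ∸ h^ k p 0            ≡⟨ cong (_∸ h^ k p 0) eq ⟩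
    n * k ∸ h^ k p 0                       ∎
    where
    eq : suc t + h^ k p 0 ≡ n * k
    eq = trans (cong suc (+-comm t (h^ k p 0))) eq′
    t<n : t < n
    t<n = index< d n p crosses eq
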